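{- Let $K(\mathcal{M})$ be a Kripke model with classical domains. If there are nodes $v < w$ in $K$ such that $\mathcal{M}_w$ is a non-trivial generic extension of $\mathcal{M}_v$ (i.e., $\mathcal{M}_w = \mathcal{M}_v[G]$ for some generic $G \notin \mathcal{M}_v$), then $K(\mathcal{M})$ is not a model of $\mathsf{CZF}$ (i.e. $K(\mathcal{M})$ does not force all axioms of $\mathsf{CZF}$).
   Context: A Kripke frame $(K,\leq)$ is a set $K$ with a partial order $\leq$. A sound assignment for $K$ is a map $v \mapsto \mathcal{M}_v$ assigning to every node $v \in K$ a transitive model $\mathcal{M}_v$ of $\mathsf{ZF}$ such that, for $v \leq w$, $\mathcal{M}_v \subseteq \mathcal{M}_w$ and membership and equality statements true in $\mathcal{M}_v$ remain true in $\mathcal{M}_w$. The Kripke model with classical domains $K(\mathcal{M})$ has underlying frame $(K,\leq)$, domain $\mathcal{M}_v$ at node $v$, and membership relation at $v$ the restriction of $\in$ to $\mathcal{M}_v$. Forcing for formulas of the language of set theory with parameters in $\mathcal{M}_v$: $v \Vdash a \in b$ iff $a \in b$; $v \Vdash a = b$ iff $a = b$; $\wedge$ and $\vee$ are evaluated pointwise at $v$; $v \Vdash \varphi \rightarrow \psi$ iff for all $w \geq v$, $w \Vdash \varphi$ implies $w \Vdash \psi$; $v \Vdash \bot$ never; $v \Vdash \exists x\, \varphi(x)$ iff $v \Vdash \varphi(a)$ for some $a \in \mathcal{M}_v$; $v \Vdash \forall x\, \varphi(x)$ iff for all $w \geq v$ and all $a \in \mathcal{M}_w$, $w \Vdash \varphi(a)$.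 $K(\mathcal{M}) \Vdash \varphi$ means $v \Vdash \varphi$ for all $v \in K$. $\mathsf{CZF}$ is the theory over intuitionistic first-order logic in the language with $\in, =$ with axioms Extensionality, Empty Set, Pairing, Union; Strong Infinity $\exists a (\mathrm{Ind}(a) \wedge \forall b (\mathrm{Ind}(b) \rightarrow \forall x \in a\, (x \in b)))$ where $\mathrm{Ind}(a)$ is $\emptyset \in a \wedge \forall x \in a \exists y \in a\; y = \{x\}$; Set Induction $(\forall a (\forall x \in a\, \varphi(x) \rightarrow \varphi(a))) \rightarrow \forall a\, \varphi(a)$; Separation for bounded formulas; Strong Collection $\forall a (\forall x \in a \exists y\, \varphi(x,y) \rightarrow \exists b (\forall x \in a \exists y \in b\, \varphi(x,y) \wedge \forall y \in b \exists x \in a\, \varphi(x,y)))$ for all formulas $\varphi$; and Subset Collection $\forall a \forall b \exists c \forall u (\forall x \in a \exists y \in b\, \psi(x,y,u) \rightarrow \exists d \in c (\forall x \in a \exists y \in d\, \psi(x,y,u) \wedge \forall y \in d \exists x \in a\, \psi(x,y,u)))$ for all formulas $\psi$. -}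

module Defs where

open import Level using (Level; Lift; _⊔_) renaming (suc to lsuc)
open import Data.Bool.Base using (Bool; true; false)
open import Data.Empty.Polymorphic using (⊥)
open import Data.Fin using (Fin; zero; suc; #_; _↑ʳ_; splitAt)
open import Data.Nat.Base using (ℕ; zero; suc; _+_)
open import Data.Product using (Σ; ∃; ∃₂; ∃-syntax; _×_; _,_)
open import Data.Sum using (_⊎_; [_,_])
open import Data.Vec.Base using (Vec; []; _∷_; lookup)
open import Relation.Binary.Bundles using (Poset)
import Relation.Binary.Properties.Poset as PosetProperties
open import Relation.Nullary using (¬_)
open import Relation.Unary using (Pred; _⊆_; _≐_)

-- The ambient universe of sets: well-founded trees, with bisimilarity
-- as equality, so that extensionality and ∈-induction hold.

data V (ℓ : Level) : Set (lsuc ℓ) where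
  sup : (A : Set ℓ) → (A → V ℓ) → V ℓ

infix 4 _≅_ _∈_

_≅_ : ∀ {ℓ} → V ℓ → V ℓ → Set ℓ
sup A f ≅ sup B g =
  (∀ a → ∃[ b ] f a ≅ g b) × (∀ b → ∃[ a ] f a ≅ g b)

_∈_ : ∀ {ℓ} → V ℓ → V ℓ → Set ℓ
x ∈ sup B g = ∃[ b ] x ≅ g b

⁅_,_⁆ : ∀ {ℓ} → V ℓ → V ℓ → V ℓ
⁅_,_⁆ {ℓ} x y = sup (Lift ℓ Bool) λ
  { (Level.lift true) → x ; (Level.lift false) → y }

⟪_,_⟫ : ∀ {ℓ} → V ℓ → V ℓ → V ℓ
⟪ x , y ⟫ = ⁅ ⁅ x , x ⁆ , ⁅ x , y ⁆ ⁆

-- The first-order language of set theory, with de Bruijn indices: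
-- a formula in `Formula n` has its free variables among 0, …, n-1, and
-- a quantifier binds index 0.

infix  9 _∈̇_ _=̇_
infixr 7 _∧̇_
infixr 6 _∨̇_
infixr 5 _⇒̇_
infix  4 _⇔̇_

data Formula (n : ℕ) : Set where
  _∈̇_ _=̇_         : Fin n → Fin n → Formula n
  ⊥̇               : Formula n
  _∧̇_ _∨̇_ _⇒̇_ : Formula n → Formula n → Formula n
  ∃̇_ ∀̇_          : Formula (suc n) → Formula n

Sentence : Set
Sentence = Formula 0

¬̇_ : ∀ {n} → Formula n → Formula n
¬̇ φ = φ ⇒̇ ⊥̇

_⇔̇_ : ∀ {n} → Formula n → Formula n → Formula n
φ ⇔̇ ψ = (φ ⇒̇ ψ) ∧̇ (ψ ⇒̇ φ)

∀∈ ∃∈ : ∀ {n} → Fin n → Formula (suc n) → Formula n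
∀∈ a φ = ∀̇ (zero ∈̇ suc a ⇒̇ φ)
∃∈ a φ = ∃̇ (zero ∈̇ suc a ∧̇ φ)

data Δ₀ {n : ℕ} : Formula n → Set where
  mem  : ∀ {i j} → Δ₀ (i ∈̇ j)
  eq   : ∀ {i j} → Δ₀ (i =̇ j)
  bot  : Δ₀ ⊥̇
  and  : ∀ {φ ψ} → Δ₀ φ → Δ₀ ψ → Δ₀ (φ ∧̇ ψ)
  or   : ∀ {φ ψ} → Δ₀ φ → Δ₀ ψ → Δ₀ (φ ∨̇ ψ)
  imp  : ∀ {φ ψ} → Δ₀ φ → Δ₀ ψ → Δ₀ (φ ⇒̇ ψ)
  all∈ : ∀ {a φ} → Δ₀ φ → Δ₀ (∀∈ a φ)
  ex∈  : ∀ {a φ} → Δ₀ φ → Δ₀ (∃∈ a φ)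

extend : ∀ {n m} → (Fin n → Fin m) → Fin (suc n) → Fin (suc m)
extend f zero    = zero
extend f (suc i) = suc (f i)

rename : ∀ {n m} → (Fin n → Fin m) → Formula n → Formula m
rename f (i ∈̇ j)  = f i ∈̇ f j
rename f (i =̇ j)  = f i =̇ f j
rename f ⊥̇        = ⊥̇
rename f (φ ∧̇ ψ)  = rename f φ ∧̇ rename f ψ
rename f (φ ∨̇ ψ)  = rename f φ ∨̇ rename f ψ
rename f (φ ⇒̇ ψ)  = rename f φ ⇒̇ rename f ψ
rename f (∃̇ φ)    = ∃̇ rename (extend f) φ
rename f (∀̇ φ)    = ∀̇ rename (extend f) φ

-- A schema formula φ has j argument variables followed by n parameters.
-- `inst k φ is` places it beneath k quantifiers, with arguments `is`.
inst : ∀ {j n} k → Formula (j + n) → Vec (Fin (k + n)) j → Formula (k + n)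
inst {j} k φ is = rename (λ i → [ lookup is , k ↑ʳ_ ] (splitAt j i)) φ

closure : ∀ {n} → Formula n → Sentence
closure {zero}  φ = φ
closure {suc n} φ = closure (∀̇ φ)

Extensionality EmptySet Pairing Union PowerSet Foundation Infinity StrongInfinity : Sentence

Extensionality = ∀̇ ∀̇ ((∀̇ (# 0 ∈̇ # 2 ⇔̇ # 0 ∈̇ # 1)) ⇒̇ # 1 =̇ # 0)

EmptySet = ∃̇ ∀̇ ¬̇ (# 0 ∈̇ # 1)

Pairing = ∀̇ ∀̇ ∃̇ ∀̇ (# 0 ∈̇ # 1 ⇔̇ # 0 =̇ # 3 ∨̇ # 0 =̇ # 2)

Union = ∀̇ ∃̇ ∀̇ (# 0 ∈̇ # 1 ⇔̇ ∃∈ (# 2) (# 1 ∈̇ # 0))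

PowerSet = ∀̇ ∃̇ ∀̇ (# 0 ∈̇ # 1 ⇔̇ ∀∈ (# 0) (# 0 ∈̇ # 3))

Foundation =
  ∀̇ ((∃̇ (# 0 ∈̇ # 1)) ⇒̇ ∃∈ (# 0) (¬̇ (∃̇ (# 0 ∈̇ # 2 ∧̇ # 0 ∈̇ # 1))))

∅∈ : ∀ {n} → Fin n → Formula n
∅∈ a = ∃∈ a (∀̇ ¬̇ (# 0 ∈̇ # 1))

Infinity =
  ∃̇ (∅∈ (# 0) ∧̇
      ∀∈ (# 0) (∃∈ (# 1) (∀̇ (# 0 ∈̇ # 1 ⇔̇ # 0 ∈̇ # 2 ∨̇ # 0 =̇ # 2))))

Ind : ∀ {n} → Fin n → Formula n
Ind a = ∅∈ a ∧̇ ∀∈ a (∃∈ (suc a) (∀̇ (# 0 ∈̇ # 1 ⇔̇ # 0 =̇ # 2)))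

StrongInfinity =
  ∃̇ (Ind (# 0) ∧̇ ∀̇ (Ind (# 0) ⇒̇ ∀∈ (# 1) (# 0 ∈̇ # 1)))

Separation : ∀ {n} → Formula (1 + n) → Sentence
Separation φ = closure
  (∀̇ ∃̇ ∀̇ (# 0 ∈̇ # 1 ⇔̇ # 0 ∈̇ # 2 ∧̇ inst 3 φ (# 0 ∷ [])))

Replacement : ∀ {n} → Formula (2 + n) → Sentence
Replacement φ = closure
  ((∀̇ ∀̇ ∀̇ (inst 3 φ (# 2 ∷ # 1 ∷ []) ∧̇ inst 3 φ (# 2 ∷ # 0 ∷ []) ⇒̇ # 1 =̇ # 0))
   ⇒̇
   (∀̇ ∃̇ ∀̇ (# 0 ∈̇ # 1 ⇔̇ ∃∈ (# 2) (inst 4 φ (# 0 ∷ # 1 ∷ [])))))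

SetInduction : ∀ {n} → Formula (1 + n) → Sentence
SetInduction φ = closure
  ((∀̇ (∀∈ (# 0) (inst 2 φ (# 0 ∷ [])) ⇒̇ inst 1 φ (# 0 ∷ [])))
   ⇒̇
   (∀̇ inst 1 φ (# 0 ∷ [])))

StrongCollection : ∀ {n} → Formula (2 + n) → Sentence
StrongCollection φ = closure
  (∀̇ (∀∈ (# 0) (∃̇ inst 3 φ (# 1 ∷ # 0 ∷ []))
       ⇒̇
       (∃̇ (∀∈ (# 1) (∃∈ (# 1) (inst 4 φ (# 1 ∷ # 0 ∷ []))) ∧̇
            ∀∈ (# 0) (∃∈ (# 2) (inst 4 φ (# 0 ∷ # 1 ∷ [])))))))

-- ψ has arguments x, y, u; the quantifier prefix is a, b, c, u, later d.
SubsetCollection : ∀ {n} → Formula (3 + n) → Sentence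
SubsetCollection ψ = closure
  (∀̇ ∀̇ ∃̇ ∀̇
    (∀∈ (# 3) (∃∈ (# 3) (inst 6 ψ (# 1 ∷ # 0 ∷ # 2 ∷ [])))
     ⇒̇
     ∃∈ (# 1)
       (∀∈ (# 4) (∃∈ (# 1) (inst 7 ψ (# 1 ∷ # 0 ∷ # 3 ∷ []))) ∧̇
        ∀∈ (# 0) (∃∈ (# 5) (inst 7 ψ (# 0 ∷ # 1 ∷ # 3 ∷ []))))))

data ZF : Sentence → Set where
  extensionality : ZF Extensionality
  foundation     : ZF Foundation
  pairing        : ZF Pairing
  union          : ZF Union
  powerSet       : ZF PowerSet
  infinity       : ZF Infinity
  separation     : ∀ {n} (φ : Formula (1 + n)) → ZF (Separation φ)
  replacement    : ∀ {n} (φ : Formula (2 + n)) → ZF (Replacement φ)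

data CZF : Sentence → Set where
  extensionality    : CZF Extensionality
  emptySet          : CZF EmptySet
  pairing           : CZF Pairing
  union             : CZF Union
  strongInfinity    : CZF StrongInfinity
  setInduction      : ∀ {n} (φ : Formula (1 + n)) → CZF (SetInduction φ)
  boundedSeparation : ∀ {n} (φ : Formula (1 + n)) → Δ₀ φ → CZF (Separation φ)
  strongCollection  : ∀ {n} (φ : Formula (2 + n)) → CZF (StrongCollection φ)
  subsetCollection  : ∀ {n} (ψ : Formula (3 + n)) → CZF (SubsetCollection ψ)

-- Tarskian truth in (M , ∈).  Environments are lists of sets; those
-- reached from the empty one contain only elements of M.
_⊨_[_] : ∀ {ℓ m n} → Pred (V ℓ) m → Formula n → Vec (V ℓ) n → Set (lsuc ℓ ⊔ m)
_⊨_[_] {ℓ} {m} M (i ∈̇ j) ρ = Lift (lsuc ℓ ⊔ m) (lookup ρ i ∈ lookup ρ j)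
_⊨_[_] {ℓ} {m} M (i =̇ j) ρ = Lift (lsuc ℓ ⊔ m) (lookup ρ i ≅ lookup ρ j)
M ⊨ ⊥̇ [ ρ ]      = ⊥
M ⊨ φ ∧̇ ψ [ ρ ] = M ⊨ φ [ ρ ] × M ⊨ ψ [ ρ ]
M ⊨ φ ∨̇ ψ [ ρ ] = M ⊨ φ [ ρ ] ⊎ M ⊨ ψ [ ρ ]
M ⊨ φ ⇒̇ ψ [ ρ ] = M ⊨ φ [ ρ ] → M ⊨ ψ [ ρ ]
M ⊨ ∃̇ φ [ ρ ]   = ∃[ a ] M a × M ⊨ φ [ a ∷ ρ ]
M ⊨ ∀̇ φ [ ρ ]   = ∀ a → M a → M ⊨ φ [ a ∷ ρ ]

record IsTransitiveModel {ℓ m} (M : Pred (V ℓ) m) : Set (lsuc ℓ ⊔ m) where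
  field
    resp-≅     : ∀ {x y} → x ≅ y → M x → M y
    transitive : ∀ {x y} → y ∈ x → M x → M y
    models-ZF  : ∀ {φ} → ZF φ → M ⊨ φ [ [] ]

-- A notion of forcing in M, given as a preorder; ⟪ q , p ⟫ ∈ R means
-- that q is stronger than p.  No largest condition is required.
record ForcingNotion {ℓ m} (M : Pred (V ℓ) m) : Set (lsuc ℓ ⊔ m) where
  field
    P R     : V ℓ
    P∈M     : M P
    R∈M     : M R
    R-refl  : ∀ {p} → p ∈ P → ⟪ p , p ⟫ ∈ R
    R-trans : ∀ {p q r} → p ∈ P → q ∈ P → r ∈ P →
              ⟪ p , q ⟫ ∈ R → ⟪ q , r ⟫ ∈ R → ⟪ p , r ⟫ ∈ R

  IsDense : V ℓ → Set (lsuc ℓ)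
  IsDense D = (∀ {p} → p ∈ D → p ∈ P) ×
              (∀ {p} → p ∈ P → ∃[ q ] q ∈ D × ⟪ q , p ⟫ ∈ R)

record IsGeneric {ℓ m} {M : Pred (V ℓ) m} (ℙ : ForcingNotion M) (G : V ℓ)
                 : Set (lsuc ℓ ⊔ m) where
  open ForcingNotion ℙ
  field
    subset   : ∀ {p} → p ∈ G → p ∈ P
    nonempty : ∃[ p ] p ∈ G
    upward   : ∀ {p q} → p ∈ G → q ∈ P → ⟪ p , q ⟫ ∈ R → q ∈ G
    directed : ∀ {p q} → p ∈ G → q ∈ G →
               ∃[ r ] r ∈ G × ⟪ r , p ⟫ ∈ R × ⟪ r , q ⟫ ∈ R
    meets    : ∀ {D} → M D → IsDense D → ∃[ p ] p ∈ D × p ∈ G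

data IsName {ℓ} (P : V ℓ) : V ℓ → Set (lsuc ℓ) where
  name : ∀ {τ} →
         (∀ {x} → x ∈ τ → ∃₂ λ σ p → x ≅ ⟪ σ , p ⟫ × p ∈ P × IsName P σ) →
         IsName P τ

-- val G τ = { val G σ ∣ ⟪ σ , p ⟫ ∈ τ for some p ∈ G }.  Such a σ is an
-- element of an element of τ, which makes the recursion structural once
-- it is threaded through two levels of children.

index : ∀ {ℓ} → V ℓ → Set ℓ
index (sup A f) = A

child : ∀ {ℓ} (x : V ℓ) → index x → V ℓ
child (sup A f) = f

index² : ∀ {ℓ} → V ℓ → Set ℓ
index² x = Σ (index x) λ b → index (child x b)

child² : ∀ {ℓ} (x : V ℓ) → index² x → V ℓ
child² x (b , c) = child (child x b) c

mutual
  val : ∀ {ℓ} → V ℓ → V ℓ → V ℓ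
  val G (sup A f) = sup
    (Σ A λ a → Σ (index² (f a)) λ i → ∃[ p ] f a ≅ ⟪ child² (f a) i , child G p ⟫)
    (λ (a , i , _) → val² G (f a) i)

  -- val² G x i = val G (child² x i)
  val² : ∀ {ℓ} → V ℓ → (x : V ℓ) → index² x → V ℓ
  val² G (sup B g) (b , c) = val¹ G (g b) c

  val¹ : ∀ {ℓ} → V ℓ → (x : V ℓ) → index x → V ℓ
  val¹ G (sup C h) c = val G (h c)

GenericExtension : ∀ {ℓ m} (M : Pred (V ℓ) m) → ForcingNotion M → V ℓ → Pred (V ℓ) (lsuc ℓ ⊔ m)
GenericExtension M ℙ G x = ∃[ τ ] M τ × IsName (ForcingNotion.P ℙ) τ × x ≅ val G τ

IsNontrivialGenericExtension : ∀ {ℓ m} → Pred (V ℓ) m → Pred (V ℓ) m → Set (lsuc ℓ ⊔ m)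
IsNontrivialGenericExtension M N =
  Σ (ForcingNotion M) λ ℙ → ∃[ G ] IsGeneric ℙ G × ¬ M G × N ≐ GenericExtension M ℙ G

-- Membership and equality at every node are those of the ambient
-- universe, so that their persistence along ≤ is automatic.
record KripkeModel c ℓ₁ ℓ₂ ℓ m : Set (lsuc (c ⊔ ℓ₁ ⊔ ℓ₂ ⊔ ℓ ⊔ m)) where
  field
    frame : Poset c ℓ₁ ℓ₂

  open Poset frame public using (_≤_) renaming (Carrier to K)
  open PosetProperties frame public using (_<_)

  field
    M                 : K → Pred (V ℓ) m
    isTransitiveModel : ∀ v → IsTransitiveModel (M v)
    M-mono            : ∀ {v w} → v ≤ w → M v ⊆ M w

  infix 3 _⊩_[_]

  _⊩_[_] : ∀ {n} → K → Formula n → Vec (V ℓ) n → Set (c ⊔ ℓ₂ ⊔ lsuc ℓ ⊔ m)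
  v ⊩ i ∈̇ j [ ρ ]   = Lift (c ⊔ ℓ₂ ⊔ lsuc ℓ ⊔ m) (lookup ρ i ∈ lookup ρ j)
  v ⊩ i =̇ j [ ρ ]   = Lift (c ⊔ ℓ₂ ⊔ lsuc ℓ ⊔ m) (lookup ρ i ≅ lookup ρ j)
  v ⊩ ⊥̇ [ ρ ]       = ⊥
  v ⊩ φ ∧̇ ψ [ ρ ]  = (v ⊩ φ [ ρ ]) × (v ⊩ ψ [ ρ ])
  v ⊩ φ ∨̇ ψ [ ρ ]  = (v ⊩ φ [ ρ ]) ⊎ (v ⊩ ψ [ ρ ])
  v ⊩ φ ⇒̇ ψ [ ρ ]  = ∀ {w} → v ≤ w → (w ⊩ φ [ ρ ]) → (w ⊩ ψ [ ρ ])
  v ⊩ ∃̇ φ [ ρ ]     = ∃[ a ] M v a × (v ⊩ φ [ a ∷ ρ ])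
  v ⊩ ∀̇ φ [ ρ ]     = ∀ {w} → v ≤ w → ∀ a → M w a → (w ⊩ φ [ a ∷ ρ ])

  Forces : Sentence → Set (c ⊔ ℓ₂ ⊔ lsuc ℓ ⊔ m)
  Forces φ = ∀ v → v ⊩ φ [ [] ]

{-# OPTIONS --safe #-}

-- Let v force CZF and let P ∈ M v. Apply Subset Collection at v with
-- a = b = P to the formula y ∈ u ∧ (x ∈ u → y = x). For an inhabited
-- G ⊆ P in some M w with w ≥ v, the instance u = G yields a set d in some
-- c ∈ M v with d = G, so G ∈ M v. Hence M w has no inhabited subset of P
-- which is not in M v, whereas the generic G is one. That G lies in M w
-- needs its canonical name { ⟪ p̌ , p ⟫ ∣ p ∈ P }, where x̌ is defined by
-- ∈-recursion inside M v. No largest condition is available, so x̌ carries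
-- every condition: x̌ = { ⟪ y̌ , p ⟫ ∣ y ∈ x, p ∈ P }, and val G x̌ = x
-- because G is inhabited.

module Submission where

open import Defs
open import Axiom.ExcludedMiddle using (ExcludedMiddle)
open import Data.Bool.Base using (true; false)
open import Data.Empty using (⊥-elim)
open import Data.Fin using (Fin; zero; suc; #_; _↑ʳ_; splitAt)
open import Data.Nat.Base using (ℕ; _+_)
open import Data.Product using (Σ; ∃₂; ∃-syntax; _×_; _,_; proj₁; proj₂; map₂)
open import Data.Sum using (_⊎_; inj₁; inj₂; [_,_])
open import Data.Vec.Base using (Vec; []; _∷_; lookup)
open import Data.Vec.Relation.Unary.All using (All; []; _∷_)
open import Data.Vec.Relation.Unary.All.Properties using (lookup⁺)
open import Level using (Level; lift; lower; _⊔_) renaming (suc to lsuc)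
open import Relation.Binary.Bundles using (Poset)
open import Relation.Binary.PropositionalEquality using (_≡_; refl; subst)
open import Relation.Nullary using (¬_; yes; no)
open import Relation.Unary using (Pred)

private variable
  ℓ m q r : Level
  n k : ℕ

-- Bisimilarity, membership and Kuratowski pairs.

≅-refl : (x : V ℓ) → x ≅ x
≅-refl (sup A f) = (λ a → a , ≅-refl (f a)) , (λ a → a , ≅-refl (f a))

≅-sym : (x y : V ℓ) → x ≅ y → y ≅ x
≅-sym (sup A f) (sup B g) (p , q) =
  (λ b → let a , e = q b in a , ≅-sym (f a) (g b) e) ,
  (λ a → let b , e = p a in b , ≅-sym (f a) (g b) e)

≅-trans : (x y z : V ℓ) → x ≅ y → y ≅ z → x ≅ z
≅-trans (sup A f) (sup B g) (sup C h) (p , q) (p′ , q′) =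
  (λ a → let b , e = p a ; c , e′ = p′ b in c , ≅-trans (f a) (g b) (h c) e e′) ,
  (λ c → let b , e′ = q′ c ; a , e = q b in a , ≅-trans (f a) (g b) (h c) e e′)

-- Since _≅_ and _∈_ compute, their arguments cannot be inferred; these
-- wrappers make them inferable.

infix 4 _≃_ _ε_

record _≃_ (x y : V ℓ) : Set ℓ where
  constructor mk≃
  field un≃ : x ≅ y
open _≃_

record _ε_ (x y : V ℓ) : Set ℓ where
  constructor mkε
  field unε : x ∈ y
open _ε_

private variable
  a b c d e f g p s t u x y z σ τ G P X : V ℓ

≃-refl : x ≃ x
≃-refl {x = x} = mk≃ (≅-refl x)

≃-sym : x ≃ y → y ≃ x
≃-sym {x = x} {y} (mk≃ p) = mk≃ (≅-sym x y p)

≃-trans : x ≃ y → y ≃ z → x ≃ z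
≃-trans {x = x} {y} {z} (mk≃ p) (mk≃ q) = mk≃ (≅-trans x y z p q)

child-ε : (x : V ℓ) (i : index x) → child x i ε x
child-ε (sup A f) i = mkε (i , ≅-refl (f i))

ε-child : x ε y → Σ (index y) λ i → x ≃ child y i
ε-child {y = sup A f} (mkε (i , p)) = i , mk≃ p

ε-respˡ : x ≃ y → x ε z → y ε z
ε-respˡ {x = x} {y} {sup A f} (mk≃ p) (mkε (i , q)) =
  mkε (i , ≅-trans y x (f i) (≅-sym x y p) q)

ε-respʳ : x ≃ y → z ε x → z ε y
ε-respʳ {x = sup A f} {sup B g} {z} (mk≃ (p , _)) (mkε (i , q)) =
  let j , q′ = p i in mkε (j , ≅-trans z (f i) (g j) q q′)

ε-ext : (∀ {z} → z ε x → z ε y) → (∀ {z} → z ε y → z ε x) → x ≃ y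
ε-ext {x = x@(sup A f)} {y@(sup B g)} p q = mk≃
  ((λ i → unε (p (child-ε x i))) ,
   (λ j → let i , r = ε-child (q (child-ε y j)) in i , ≅-sym (g j) (f i) (un≃ r)))

ε-induction : {Q : V ℓ → Set q} →
              (∀ x → (∀ {y} → y ε x → Q y) → Q x) → ∀ x → Q x
ε-induction {ℓ = ℓ} {Q = Q} step x = go x ≃-refl
  where
  -- The recursion is structural on the tree `x`, but an element of `y` is only bisimilar to a child
  -- of `x`; hence the generalisation to every `y ≃ x`.
  go : (x : V ℓ) → y ≃ x → Q y
  go (sup A f) p = step _ λ q →
    let i , r = ε-child (ε-respʳ p q) in go (f i) r

upair-elim : z ε ⁅ a , b ⁆ → z ≃ a ⊎ z ≃ b
upair-elim (mkε (lift true  , p)) = inj₁ (mk≃ p)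
upair-elim (mkε (lift false , p)) = inj₂ (mk≃ p)

upair-left : a ε ⁅ a , b ⁆
upair-left = mkε (lift true , un≃ ≃-refl)

upair-right : b ε ⁅ a , b ⁆
upair-right = mkε (lift false , un≃ ≃-refl)

upair-intro : (∀ {z} → z ε c → z ≃ a ⊎ z ≃ b) → a ε c → b ε c → c ≃ ⁅ a , b ⁆
upair-intro h p q = ε-ext
  (λ r → [ (λ e → ε-respˡ (≃-sym e) upair-left)
         , (λ e → ε-respˡ (≃-sym e) upair-right) ] (h r))
  (λ r → [ (λ e → ε-respˡ (≃-sym e) p)
         , (λ e → ε-respˡ (≃-sym e) q) ] (upair-elim r))

upair-cong : a ≃ c → b ≃ d → ⁅ a , b ⁆ ≃ ⁅ c , d ⁆
upair-cong p q = upair-intro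
  (λ r → [ (λ e → inj₁ (≃-trans e p)) , (λ e → inj₂ (≃-trans e q)) ] (upair-elim r))
  (ε-respˡ p upair-left) (ε-respˡ q upair-right)

pair-cong : a ≃ c → b ≃ d → ⟪ a , b ⟫ ≃ ⟪ c , d ⟫
pair-cong p q = upair-cong (upair-cong p p) (upair-cong p q)

singleton-injective : ⁅ a , a ⁆ ≃ ⁅ c , d ⁆ → a ≃ c
singleton-injective p =
  [ ≃-sym , ≃-sym ] (upair-elim (ε-respʳ (≃-sym p) upair-left))

pair-injectiveˡ : ⟪ a , b ⟫ ≃ ⟪ c , d ⟫ → a ≃ c
pair-injectiveˡ p =
  [ singleton-injective , singleton-injective ] (upair-elim (ε-respʳ p upair-left))

private
  second : ⟪ a , b ⟫ ≃ ⟪ c , d ⟫ → b ≃ c ⊎ b ≃ d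
  second p with upair-elim (ε-respʳ p upair-right)
  ... | inj₁ q = [ inj₁ , inj₁ ] (upair-elim (ε-respʳ q upair-right))
  ... | inj₂ q = upair-elim (ε-respʳ q upair-right)

pair-injectiveʳ : ⟪ a , b ⟫ ≃ ⟪ c , d ⟫ → b ≃ d
pair-injectiveʳ p with second p | second (≃-sym p)
... | inj₂ q | _      = q
... | inj₁ _ | inj₂ r = ≃-sym r
-- The degenerate case: here `b ≃ c` and `d ≃ a`, and the first components agree, so all four sets
-- coincide.
... | inj₁ q | inj₁ r = ≃-trans q (≃-trans (≃-sym (pair-injectiveˡ p)) (≃-sym r))

-- Truth under renaming of variables.

module _ {M : Pred (V ℓ) m} where

  mutual
    -- An implication exchanges the two directions in its premise, so they are proved together.
    ⊨-rename⁺ : (h : Fin n → Fin k) {ρ : Vec (V ℓ) n} {ρ′ : Vec (V ℓ) k} →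
                (∀ i → lookup ρ′ (h i) ≡ lookup ρ i) →
                (φ : Formula n) → M ⊨ φ [ ρ ] → M ⊨ rename h φ [ ρ′ ]
    ⊨-rename⁺ h H (i ∈̇ j) s rewrite H i | H j = s
    ⊨-rename⁺ h H (i =̇ j) s rewrite H i | H j = s
    ⊨-rename⁺ h H (φ ∧̇ ψ) (s , t) = ⊨-rename⁺ h H φ s , ⊨-rename⁺ h H ψ t
    ⊨-rename⁺ h H (φ ∨̇ ψ) (inj₁ s) = inj₁ (⊨-rename⁺ h H φ s)
    ⊨-rename⁺ h H (φ ∨̇ ψ) (inj₂ s) = inj₂ (⊨-rename⁺ h H ψ s)
    ⊨-rename⁺ h H (φ ⇒̇ ψ) s t = ⊨-rename⁺ h H ψ (s (⊨-rename⁻ h H φ t))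
    ⊨-rename⁺ h H (∃̇ φ) (a , Ma , s) =
      a , Ma , ⊨-rename⁺ (extend h) (λ { zero → refl ; (suc i) → H i }) φ s
    ⊨-rename⁺ h H (∀̇ φ) s a Ma =
      ⊨-rename⁺ (extend h) (λ { zero → refl ; (suc i) → H i }) φ (s a Ma)

    ⊨-rename⁻ : (h : Fin n → Fin k) {ρ : Vec (V ℓ) n} {ρ′ : Vec (V ℓ) k} →
                (∀ i → lookup ρ′ (h i) ≡ lookup ρ i) →
                (φ : Formula n) → M ⊨ rename h φ [ ρ′ ] → M ⊨ φ [ ρ ]
    ⊨-rename⁻ h H (i ∈̇ j) s rewrite H i | H j = s
    ⊨-rename⁻ h H (i =̇ j) s rewrite H i | H j = s
    ⊨-rename⁻ h H (φ ∧̇ ψ) (s , t) = ⊨-rename⁻ h H φ s , ⊨-rename⁻ h H ψ t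
    ⊨-rename⁻ h H (φ ∨̇ ψ) (inj₁ s) = inj₁ (⊨-rename⁻ h H φ s)
    ⊨-rename⁻ h H (φ ∨̇ ψ) (inj₂ s) = inj₂ (⊨-rename⁻ h H ψ s)
    ⊨-rename⁻ h H (φ ⇒̇ ψ) s t = ⊨-rename⁻ h H ψ (s (⊨-rename⁺ h H φ t))
    ⊨-rename⁻ h H (∃̇ φ) (a , Ma , s) =
      a , Ma , ⊨-rename⁻ (extend h) (λ { zero → refl ; (suc i) → H i }) φ s
    ⊨-rename⁻ h H (∀̇ φ) s a Ma =
      ⊨-rename⁻ (extend h) (λ { zero → refl ; (suc i) → H i }) φ (s a Ma)

  closure-elim : (φ : Formula n) → M ⊨ closure φ [ [] ] →
                 {ρ : Vec (V ℓ) n} → All M ρ → M ⊨ φ [ ρ ]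
  closure-elim φ s []        = s
  closure-elim φ s (Ma ∷ Mρ) = closure-elim (∀̇ φ) s Mρ _ Ma

-- Attempts at the recursion x ↦ x̌ = { ⟪ y̌ , p ⟫ ∣ y ∈ x, p ∈ P }.

record Member (P f x e : V ℓ) : Set (lsuc ℓ) where
  constructor member
  field
    {predecessor image condition} : V ℓ
    predecessor-ε : predecessor ε x
    image-ε       : ⟪ predecessor , image ⟫ ε f
    condition-ε   : condition ε P
    pair-≃        : e ≃ ⟪ image , condition ⟫

InDomain : V ℓ → V ℓ → Set (lsuc ℓ)
InDomain f x = ∃[ s ] ⟪ x , s ⟫ ε f

-- A partial solution of the recursion, as a set of pairs whose domain is closed under elements.
-- Single-valuedness is no field: it is `attempt-unique` with both attempts equal.
record Attempt (P f : V ℓ) : Set (lsuc ℓ) where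
  field
    downward : ⟪ x , t ⟫ ε f → y ε x → InDomain f y
    sound    : ⟪ x , t ⟫ ε f → e ε t → Member P f x e
    complete : ⟪ x , t ⟫ ε f → y ε x → ⟪ y , s ⟫ ε f → p ε P → ⟪ s , p ⟫ ε t
open Attempt

-- By induction on `x`: a member of `s` is a pair of an image and a condition; the image is also the
-- value of `g` at that predecessor, so `complete` puts the pair into `t`. `Q` states one inclusion
-- for all pairs of attempts, so the induction hypothesis can be used with the roles exchanged.
attempt-unique : ∀ x → Attempt P f → Attempt P g →
                 ⟪ x , s ⟫ ε f → ⟪ x , t ⟫ ε g → s ≃ t
attempt-unique {P = P} x F H p q =
  ε-ext (ε-induction {Q = Q} step x F H p q) (ε-induction {Q = Q} step x H F q p)
  where
  Q : V _ → Set _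
  Q x = ∀ {f g s t} → Attempt P f → Attempt P g →
        ⟪ x , s ⟫ ε f → ⟪ x , t ⟫ ε g → ∀ {e} → e ε s → e ε t

  step : ∀ x → (∀ {y} → y ε x → Q y) → Q x
  step x IH F H p q r with sound F p r
  ... | member y∈x ys∈f p∈P e≃ with downward H q y∈x
  ... | s′ , ys′∈g =
    let s≃s′ = ε-ext (IH y∈x F H ys∈f ys′∈g) (IH y∈x H F ys′∈g ys∈f)
    in ε-respˡ (≃-trans (pair-cong (≃-sym s≃s′) ≃-refl) (≃-sym e≃))
               (complete H q y∈x ys′∈g p∈P)

-- Definable and absolute properties over a transitive model.

module TransitiveModel {M : Pred (V ℓ) m} (isTransitiveModel : IsTransitiveModel M) where
  open IsTransitiveModel isTransitiveModel

  M-resp : x ≃ y → M x → M y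
  M-resp {x} {y} (mk≃ p) = resp-≅ {x} {y} p

  M-ε : x ε y → M y → M x
  M-ε {x} {y} (mkε p) = transitive {y} {x} p

  M-pairˡ : M ⟪ a , b ⟫ → M a
  M-pairˡ Mp = M-ε upair-left (M-ε upair-left Mp)

  M-pairʳ : M ⟪ a , b ⟫ → M b
  M-pairʳ Mp = M-ε upair-right (M-ε upair-right Mp)

  -- Carries a formula together with its correctness over `M`. The property `Q` itself is stated in
  -- the ambient universe, so building `Definable Q` also proves absoluteness where `Q` does not
  -- mention `M`.
  record Definable (Q : Vec (V ℓ) n → Set q) : Set (lsuc ℓ ⊔ m ⊔ q) where
    constructor definable
    field
      formula : Formula n
      to      : ∀ {ρ} → All M ρ → M ⊨ formula [ ρ ] → Q ρ
      from    : ∀ {ρ} → All M ρ → Q ρ → M ⊨ formula [ ρ ]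
  open Definable

  private variable
    Q : Vec (V ℓ) n → Set q
    R : Vec (V ℓ) n → Set r

  equiv : (∀ {ρ} → All M ρ → Q ρ → R ρ) → (∀ {ρ} → All M ρ → R ρ → Q ρ) →
          Definable Q → Definable R
  equiv h k D = definable (formula D)
    (λ Mρ s → h Mρ (to D Mρ s)) (λ Mρ s → from D Mρ (k Mρ s))

  εᵈ : (i j : Fin n) → Definable λ ρ → lookup ρ i ε lookup ρ j
  εᵈ i j = definable (i ∈̇ j) (λ _ s → mkε (lower s)) (λ _ s → lift (unε s))

  ≃ᵈ : (i j : Fin n) → Definable λ ρ → lookup ρ i ≃ lookup ρ j
  ≃ᵈ i j = definable (i =̇ j) (λ _ s → mk≃ (lower s)) (λ _ s → lift (un≃ s))

  infixr 7 _×ᵈ_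
  infixr 6 _⊎ᵈ_
  infixr 5 _→ᵈ_

  _×ᵈ_ : Definable Q → Definable R → Definable λ ρ → Q ρ × R ρ
  D ×ᵈ E = definable (formula D ∧̇ formula E)
    (λ Mρ (s , t) → to D Mρ s , to E Mρ t)
    (λ Mρ (s , t) → from D Mρ s , from E Mρ t)

  _⊎ᵈ_ : Definable Q → Definable R → Definable λ ρ → Q ρ ⊎ R ρ
  D ⊎ᵈ E = definable (formula D ∨̇ formula E)
    (λ Mρ → [ (λ s → inj₁ (to D Mρ s)) , (λ s → inj₂ (to E Mρ s)) ])
    (λ Mρ → [ (λ s → inj₁ (from D Mρ s)) , (λ s → inj₂ (from E Mρ s)) ])

  _→ᵈ_ : Definable Q → Definable R → Definable λ ρ → Q ρ → R ρ
  D →ᵈ E = definable (formula D ⇒̇ formula E)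
    (λ Mρ s t → to E Mρ (s (from D Mρ t)))
    (λ Mρ s t → from E Mρ (s (to D Mρ t)))

  ∀ᴹᵈ : Definable Q → Definable λ ρ → ∀ a → M a → Q (a ∷ ρ)
  ∀ᴹᵈ D = definable (∀̇ formula D)
    (λ Mρ s a Ma → to D (Ma ∷ Mρ) (s a Ma))
    (λ Mρ s a Ma → from D (Ma ∷ Mρ) (s a Ma))

  ∃ᴹᵈ : Definable Q → Definable λ ρ → ∃[ a ] M a × Q (a ∷ ρ)
  ∃ᴹᵈ D = definable (∃̇ formula D)
    (λ Mρ (a , Ma , s) → a , Ma , to D (Ma ∷ Mρ) s)
    (λ Mρ (a , Ma , s) → a , Ma , from D (Ma ∷ Mρ) s)

  -- The formula quantifies over `M`, the property over the whole universe; transitivity makes the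
  -- bounded ranges agree. The pair and value quantifiers below rest on the same fact.
  ∀εᵈ : (i : Fin n) → Definable Q →
        Definable λ ρ → ∀ a → a ε lookup ρ i → Q (a ∷ ρ)
  ∀εᵈ i D = equiv
    (λ Mρ s a p → s a (M-ε p (lookup⁺ Mρ i)) p)
    (λ _ s a _ → s a)
    (∀ᴹᵈ (εᵈ zero (suc i) →ᵈ D))

  ∃εᵈ : (i : Fin n) → Definable Q →
        Definable λ ρ → ∃[ a ] a ε lookup ρ i × Q (a ∷ ρ)
  ∃εᵈ i D = equiv
    (λ _ (a , _ , s) → a , s)
    (λ Mρ (a , p , s) → a , M-ε p (lookup⁺ Mρ i) , p , s)
    (∃ᴹᵈ (εᵈ zero (suc i) ×ᵈ D))

  upairᵈ : (i j k : Fin n) → Definable λ ρ → lookup ρ i ≃ ⁅ lookup ρ j , lookup ρ k ⁆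
  upairᵈ i j k = equiv
    (λ _ (h , p , q) → upair-intro (h _) p q)
    (λ _ p → (λ _ q → upair-elim (ε-respʳ p q)) ,
             ε-respʳ (≃-sym p) upair-left , ε-respʳ (≃-sym p) upair-right)
    (∀εᵈ i (≃ᵈ zero (suc j) ⊎ᵈ ≃ᵈ zero (suc k)) ×ᵈ εᵈ j i ×ᵈ εᵈ k i)

  pairᵈ : (i j k : Fin n) → Definable λ ρ → lookup ρ i ≃ ⟪ lookup ρ j , lookup ρ k ⟫
  pairᵈ i j k = equiv
    (λ _ (h , (_ , p , p′) , (_ , q , q′)) →
      upair-intro (h _) (ε-respˡ p′ p) (ε-respˡ q′ q))
    (λ _ p → (λ _ q → upair-elim (ε-respʳ p q)) ,
             (_ , ε-respʳ (≃-sym p) upair-left , ≃-refl) ,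
             (_ , ε-respʳ (≃-sym p) upair-right , ≃-refl))
    (∀εᵈ i (upairᵈ zero (suc j) (suc j) ⊎ᵈ upairᵈ zero (suc j) (suc k)) ×ᵈ
     ∃εᵈ i (upairᵈ zero (suc j) (suc j)) ×ᵈ
     ∃εᵈ i (upairᵈ zero (suc j) (suc k)))

  pairεᵈ : (i j k : Fin n) → Definable λ ρ → ⟪ lookup ρ i , lookup ρ j ⟫ ε lookup ρ k
  pairεᵈ i j k = equiv
    (λ _ (_ , p , q) → ε-respˡ q p)
    (λ _ p → _ , p , ≃-refl)
    (∃εᵈ k (pairᵈ zero (suc i) (suc j)))

  ∀pairᵈ : (i : Fin n) → Definable Q →
           Definable λ ρ → ∀ x y → ⟪ x , y ⟫ ε lookup ρ i → Q (y ∷ x ∷ ρ)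
  ∀pairᵈ i D = equiv
    (λ Mρ s x y p → let Mp = M-ε p (lookup⁺ Mρ i) in
      s x (M-pairˡ Mp) y (M-pairʳ Mp) p)
    (λ _ s x _ y _ → s x y)
    (∀ᴹᵈ (∀ᴹᵈ (pairεᵈ (# 1) zero (suc (suc i)) →ᵈ D)))

  ∀valueᵈ : (i j : Fin n) → Definable Q →
            Definable λ ρ → ∀ y → ⟪ lookup ρ i , y ⟫ ε lookup ρ j → Q (y ∷ ρ)
  ∀valueᵈ i j D = equiv
    (λ Mρ s y p → s y (M-pairʳ (M-ε p (lookup⁺ Mρ j))) p)
    (λ _ s y _ → s y)
    (∀ᴹᵈ (pairεᵈ (suc i) zero (suc j) →ᵈ D))

  ∃valueᵈ : (i j : Fin n) → Definable Q →
            Definable λ ρ → ∃[ y ] ⟪ lookup ρ i , y ⟫ ε lookup ρ j × Q (y ∷ ρ)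
  ∃valueᵈ i j D = equiv
    (λ _ (y , _ , s) → y , s)
    (λ Mρ (y , p , s) → y , M-pairʳ (M-ε p (lookup⁺ Mρ j)) , p , s)
    (∃ᴹᵈ (pairεᵈ (suc i) zero (suc j) ×ᵈ D))

  inDomainᵈ : (i j : Fin n) → Definable λ ρ → InDomain (lookup ρ i) (lookup ρ j)
  inDomainᵈ i j = equiv
    (λ _ (y , _ , p) → y , p)
    (λ Mρ (y , p) → y , M-pairʳ (M-ε p (lookup⁺ Mρ i)) , p)
    (∃ᴹᵈ (pairεᵈ (suc j) zero (suc i)))

  memberᵈ : (P f x e : Fin n) →
            Definable λ ρ → Member (lookup ρ P) (lookup ρ f) (lookup ρ x) (lookup ρ e)
  memberᵈ P f x e = equiv
    (λ _ (_ , y∈x , _ , ys∈f , _ , p∈P , e≃) → member y∈x ys∈f p∈P e≃)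
    (λ _ (member y∈x ys∈f p∈P e≃) → _ , y∈x , _ , ys∈f , _ , p∈P , e≃)
    (∃εᵈ x (∃valueᵈ zero (suc f) (∃εᵈ (suc (suc P))
      (pairᵈ (suc (suc (suc e))) (# 1) zero))))

  -- Every quantifier in `Attempt` is bounded by `f`, `P` or the components of a pair in `f`. All
  -- three fields start from such a pair, hence the single outer `∀pairᵈ`.
  attemptᵈ : (P f : Fin n) → Definable λ ρ → Attempt (lookup ρ P) (lookup ρ f)
  attemptᵈ P f = equiv
    (λ _ h → record
      { downward = λ p q → proj₁ (h _ _ p) _ q
      ; sound    = λ p q → proj₁ (proj₂ (h _ _ p)) _ q
      ; complete = λ p q r s → proj₂ (proj₂ (h _ _ p)) _ q _ r _ s })
    (λ _ F _ _ p →
      (λ _ → downward F p) , (λ _ → sound F p) , (λ _ q _ r _ → complete F p q r))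
    (∀pairᵈ f
      (∀εᵈ (# 1) (inDomainᵈ (suc (suc (suc f))) zero) ×ᵈ
       ∀εᵈ zero (memberᵈ (suc (suc (suc P))) (suc (suc (suc f))) (# 2) zero) ×ᵈ
       ∀εᵈ (# 1) (∀valueᵈ zero (suc (suc (suc f)))
         (∀εᵈ (suc (suc (suc (suc P)))) (pairεᵈ (# 1) zero (# 3))))))

  separate : Definable Q → {ρ : Vec (V ℓ) n} → All M ρ → M a →
             ∃[ b ] M b × (∀ {z} → z ε b → z ε a × Q (z ∷ ρ)) ×
                          (∀ {z} → z ε a → Q (z ∷ ρ) → z ε b)
  separate {n = n} {a = a} D {ρ} Mρ Ma
    with closure-elim _ (models-ZF (separation (formula D))) Mρ a Ma
  ... | b , Mb , h =
    b , Mb ,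
    (λ {z} p → let Mz = M-ε p Mb
                   q , s = proj₁ (h z Mz) (lift (unε p))
               in mkε (lower q) , to D (Mz ∷ Mρ) (⊨-rename⁻ _ H (formula D) s)) ,
    (λ {z} p s → let Mz = M-ε p Ma in
      mkε (lower (proj₂ (h z Mz)
        (lift (unε p) , ⊨-rename⁺ _ H (formula D) (from D (Mz ∷ Mρ) s)))))
    where
    -- Beneath the binders of `a`, `b` and `z`, `inst 3` skips `a` and `b`, so the formula still
    -- reads `z ∷ ρ`.
    H : ∀ {z b} (i : Fin (1 + n)) →
        lookup (z ∷ b ∷ a ∷ ρ) ([ lookup (# 0 ∷ []) , 3 ↑ʳ_ ] (splitAt 1 i)) ≡
        lookup (z ∷ ρ) i
    H zero    = refl
    H (suc i) = refl

  replace : Definable Q → {ρ : Vec (V ℓ) n} → All M ρ →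
            (∀ {x y z} → M x → M y → M z →
              Q (x ∷ y ∷ ρ) → Q (x ∷ z ∷ ρ) → y ≃ z) →
            M a →
            ∃[ b ] M b × (∀ {y} → y ε b → ∃[ x ] x ε a × Q (x ∷ y ∷ ρ)) ×
                         (∀ {x y} → x ε a → M y → Q (x ∷ y ∷ ρ) → y ε b)
  replace {n = n} {a = a} D {ρ} Mρ functional Ma
    with closure-elim _ (models-ZF (replacement (formula D))) Mρ
      (λ x Mx y My z Mz (s , t) → lift (un≃ (functional Mx My Mz
        (to D (Mx ∷ My ∷ Mρ) (⊨-rename⁻ _ H₁ (formula D) s))
        (to D (Mx ∷ Mz ∷ Mρ) (⊨-rename⁻ _ H₂ (formula D) t)))))
      a Ma
    where
    H₁ : ∀ {x y z} (i : Fin (2 + n)) →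
         lookup (z ∷ y ∷ x ∷ ρ) ([ lookup (# 2 ∷ # 1 ∷ []) , 3 ↑ʳ_ ] (splitAt 2 i)) ≡
         lookup (x ∷ y ∷ ρ) i
    H₁ zero          = refl
    H₁ (suc zero)    = refl
    H₁ (suc (suc i)) = refl

    H₂ : ∀ {x y z} (i : Fin (2 + n)) →
         lookup (z ∷ y ∷ x ∷ ρ) ([ lookup (# 2 ∷ # 0 ∷ []) , 3 ↑ʳ_ ] (splitAt 2 i)) ≡
         lookup (x ∷ z ∷ ρ) i
    H₂ zero          = refl
    H₂ (suc zero)    = refl
    H₂ (suc (suc i)) = refl
  ... | b , Mb , h =
    b , Mb ,
    (λ {y} p → let My = M-ε p Mb
                   x , Mx , q , s = proj₁ (h y My) (lift (unε p))
               in x , mkε (lower q) , to D (Mx ∷ My ∷ Mρ) (⊨-rename⁻ _ H (formula D) s)) ,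
    (λ {x} {y} p My s → let Mx = M-ε p Ma in
      mkε (lower (proj₂ (h y My) (x , Mx , lift (unε p) ,
        ⊨-rename⁺ _ H (formula D) (from D (Mx ∷ My ∷ Mρ) s)))))
    where
    H : ∀ {x y b} (i : Fin (2 + n)) →
        lookup (x ∷ y ∷ b ∷ a ∷ ρ) ([ lookup (# 0 ∷ # 1 ∷ []) , 4 ↑ʳ_ ] (splitAt 2 i)) ≡
        lookup (x ∷ y ∷ ρ) i
    H zero          = refl
    H (suc zero)    = refl
    H (suc (suc i)) = refl

  -- Closure of the model under set constructions.

  M-upair : M a → M b → M ⁅ a , b ⁆
  M-upair {a} {b} Ma Mb with models-ZF pairing a Ma b Mb
  ... | c , Mc , h = M-resp (upair-intro
    (λ {z} p → [ (λ q → inj₁ (mk≃ (lower q))) , (λ q → inj₂ (mk≃ (lower q))) ]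
                 (proj₁ (h z (M-ε p Mc)) (lift (unε p))))
    (mkε (lower (proj₂ (h a Ma) (inj₁ (lift (un≃ ≃-refl))))))
    (mkε (lower (proj₂ (h b Mb) (inj₂ (lift (un≃ ≃-refl))))))) Mc

  M-pair : M a → M b → M ⟪ a , b ⟫
  M-pair Ma Mb = M-upair (M-upair Ma Ma) (M-upair Ma Mb)

  M-union : M a → ∃[ u ] M u × (∀ {z} → z ε u → ∃[ y ] y ε a × z ε y) ×
                               (∀ {y z} → y ε a → z ε y → z ε u)
  M-union {a} Ma with models-ZF union a Ma
  ... | u , Mu , h =
    u , Mu ,
    (λ {z} p → let y , _ , q , r = proj₁ (h z (M-ε p Mu)) (lift (unε p))
               in y , mkε (lower q) , mkε (lower r)) ,
    (λ {y} {z} p q → let My = M-ε p Ma in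
      mkε (lower (proj₂ (h z (M-ε q My)) (y , My , lift (unε p) , lift (unε q)))))

  M-∪ : M a → M b → ∃[ u ] M u × (∀ {z} → z ε u → z ε a ⊎ z ε b) ×
                           (∀ {z} → z ε a → z ε u) × (∀ {z} → z ε b → z ε u)
  M-∪ Ma Mb with M-union (M-upair Ma Mb)
  ... | u , Mu , h , k =
    u , Mu ,
    (λ p → let _ , q , r = h p in
      [ (λ e → inj₁ (ε-respʳ e r)) , (λ e → inj₂ (ε-respʳ e r)) ] (upair-elim q)) ,
    k upair-left , k upair-right

  M-power : M a → ∃[ b ] M b × (∀ {z} → M z → (∀ {u} → u ε z → u ε a) → z ε b)
  M-power {a} Ma with models-ZF powerSet a Ma
  ... | b , Mb , h = b , Mb , λ {z} Mz s →
    mkε (lower (proj₂ (h z Mz) λ u _ p → lift (unε (s (mkε (lower p))))))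

  -- The double power set of the union of `a` and `b` contains all the pairs. A superset of the
  -- product suffices, since Separation is applied to it afterwards.
  M-product : M a → M b → ∃[ c ] M c × (∀ {x y} → x ε a → y ε b → ⟪ x , y ⟫ ε c)
  M-product Ma Mb =
    let u , Mu , _ , inˡ , inʳ = M-∪ Ma Mb
        v , Mv , in-v = M-power Mu
        w , Mw , in-w = M-power Mv
        upair-in : ∀ {x y} → x ε u → y ε u → ⁅ x , y ⁆ ε v
        upair-in = λ p q → in-v (M-upair (M-ε p Mu) (M-ε q Mu))
          λ r → [ (λ e → ε-respˡ (≃-sym e) p) , (λ e → ε-respˡ (≃-sym e) q) ] (upair-elim r)
    in w , Mw , λ p q →
      in-w (M-pair (M-ε p Ma) (M-ε q Mb)) λ r →
        [ (λ e → ε-respˡ (≃-sym e) (upair-in (inˡ p) (inˡ p)))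
        , (λ e → ε-respˡ (≃-sym e) (upair-in (inˡ p) (inʳ q))) ] (upair-elim r)

  -- Two unions reach `y`, along `y ε ⁅ x , y ⁆` and `⁅ x , y ⁆ ε ⟪ x , y ⟫`.
  M-range : M f → ∃[ c ] M c × (∀ {x y} → ⟪ x , y ⟫ ε f → y ε c)
  M-range Mf =
    let u , Mu , _ , in-u = M-union Mf
        v , Mv , _ , in-v = M-union Mu
    in v , Mv , λ p → in-v (in-u p upair-right) upair-right

  -- Minimality makes the attempt for x unique, so that Replacement can
  -- collect the attempts for the elements of a set.
  record MinimalAttempt (P x f : V ℓ) : Set (lsuc ℓ ⊔ m) where
    field
      attempt  : Attempt P f
      inDomain : InDomain f x
      least    : ∀ {g} → M g → Attempt P g → InDomain g x → ∀ {e} → e ε f → e ε g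
  open MinimalAttempt

  -- The clause `least` is unbounded; it is expressible because it ranges over attempts in `M` only.
  minimalAttemptᵈ : (P x f : Fin n) →
                    Definable λ ρ → MinimalAttempt (lookup ρ P) (lookup ρ x) (lookup ρ f)
  minimalAttemptᵈ P x f = equiv
    (λ _ (F , dom , h) → record
      { attempt = F ; inDomain = dom ; least = λ Mg H dom′ → h _ Mg (H , dom′) _ })
    (λ _ F → attempt F , inDomain F , λ _ Mg (H , dom′) _ → least F Mg H dom′)
    (attemptᵈ P f ×ᵈ inDomainᵈ f x ×ᵈ
     ∀ᴹᵈ (attemptᵈ (suc P) zero ×ᵈ inDomainᵈ zero (suc x) →ᵈ
          ∀εᵈ (suc f) (εᵈ zero (# 1))))

  -- Existence of an attempt at every element of the model.

  attempt-extend :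
    Attempt P u → (∀ {y} → y ε x → InDomain u y) →
    (∀ {e} → e ε t → Member P u x e) →
    (∀ {y s p} → y ε x → ⟪ y , s ⟫ ε u → p ε P → ⟪ s , p ⟫ ε t) →
    (∀ {z} → z ε f → z ε u ⊎ z ≃ ⟪ x , t ⟫) →
    (∀ {z} → z ε u → z ε f) →
    Attempt P f
  attempt-extend {P = P} {u = u} {x = x} {t = t} {f = f} U dom snd cmp old-or-new u⊆f = record
    { downward = λ p q → map₂ u⊆f (downward′ (split p) q)
    ; sound    = λ p q → weaken (sound′ (split p) q)
    ; complete = λ p q r s → complete′ (split p) q (old (downward′ (split p) q) r) s }
    where
    split : ⟪ y , s ⟫ ε f → ⟪ y , s ⟫ ε u ⊎ (y ≃ x × s ≃ t)
    split p with old-or-new p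
    ... | inj₁ q = inj₁ q
    ... | inj₂ e = inj₂ (pair-injectiveˡ e , pair-injectiveʳ e)

    weaken : Member P u y e → Member P f y e
    weaken (member p q r e) = member p (u⊆f q) r e

    -- Should `u` already have a value at `x`, the recursion forces it to be `t`, so adjoining
    -- `⟪ x , t ⟫` creates no conflict.
    x-value : ⟪ x , s ⟫ ε u → s ≃ t
    x-value p = ε-ext
      (λ q → let member y∈ ys∈ p∈ e≃ = sound U p q in
        ε-respˡ (≃-sym e≃) (cmp y∈ ys∈ p∈))
      (λ q → let member y∈ ys∈ p∈ e≃ = snd q in
        ε-respˡ (≃-sym e≃) (complete U p y∈ ys∈ p∈))

    -- In `complete` the value at the predecessor may be the new pair; since the predecessor is
    -- already in the domain of `u`, that pair then lies in `u` too.
    old : InDomain u y → ⟪ y , s ⟫ ε f → ⟪ y , s ⟫ ε u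
    old (s′ , q) p with split p
    ... | inj₁ r = r
    ... | inj₂ (y≃x , s≃t) =
      ε-respˡ (pair-cong ≃-refl (≃-trans
        (x-value (ε-respˡ (pair-cong y≃x ≃-refl) q)) (≃-sym s≃t))) q

    downward′ : ⟪ y , s ⟫ ε u ⊎ (y ≃ x × s ≃ t) → z ε y → InDomain u z
    downward′ (inj₁ p)         q = downward U p q
    downward′ (inj₂ (y≃x , _)) q = dom (ε-respʳ y≃x q)

    sound′ : ⟪ y , s ⟫ ε u ⊎ (y ≃ x × s ≃ t) → e ε s → Member P u y e
    sound′ (inj₁ p) q = sound U p q
    sound′ (inj₂ (y≃x , s≃t)) q =
      let member y∈ ys∈ p∈ e≃ = snd (ε-respʳ s≃t q)
      in member (ε-respʳ (≃-sym y≃x) y∈) ys∈ p∈ e≃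

    complete′ : ⟪ y , s ⟫ ε u ⊎ (y ≃ x × s ≃ t) →
                z ε y → ⟪ z , σ ⟫ ε u → p ε P → ⟪ σ , p ⟫ ε s
    complete′ (inj₁ p) q r w = complete U p q r w
    complete′ (inj₂ (y≃x , s≃t)) q r w =
      ε-respʳ (≃-sym s≃t) (cmp (ε-respʳ y≃x q) r w)

  collect-attempts : M P → M x → ∃[ c ] M c ×
    (∀ {f} → f ε c → ∃[ y ] y ε x × MinimalAttempt P y f) ×
    (∀ {y f} → y ε x → M f → MinimalAttempt P y f → f ε c)
  collect-attempts MP = replace (minimalAttemptᵈ (# 2) (# 0) (# 1)) (MP ∷ [])
    λ _ Mf Mg F H → ε-ext (least F Mg (attempt H) (inDomain H))
                          (least H Mf (attempt F) (inDomain F))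

  attempt-union : M P → M x → (∀ {y} → y ε x → ∃[ f ] M f × MinimalAttempt P y f) →
    ∃[ u ] M u × Attempt P u × (∀ {y} → y ε x → InDomain u y) ×
           (∀ {z} → z ε u → ∃₂ λ y f → y ε x × MinimalAttempt P y f × z ε f)
  attempt-union {P} {x} MP Mx exists =
    let c , Mc , c-sound , c-complete = collect-attempts MP Mx
        u , Mu , u-sound , u-complete = M-union Mc
    in u , Mu , union-attempt c-sound u-sound u-complete ,
       (λ p → let f , Mf , F = exists p in
         map₂ (u-complete (c-complete p Mf F)) (inDomain F)) ,
       (λ p → let f , f∈c , q = u-sound p
                  y , y∈x , F = c-sound f∈c
              in y , f , y∈x , F , q)
    where
    union-attempt : (∀ {f} → f ε c → ∃[ y ] y ε x × MinimalAttempt P y f) →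
                    (∀ {z} → z ε u → ∃[ f ] f ε c × z ε f) →
                    (∀ {f z} → f ε c → z ε f → z ε u) → Attempt P u
    union-attempt {c} {u} c-sound u-sound u-complete = record
      { downward = λ p q →
          let _ , f∈c , r = u-sound p
          in map₂ (u-complete f∈c) (downward (attempt-of f∈c) r q)
      ; sound = λ p q →
          let _ , f∈c , r = u-sound p
              member y∈ ys∈ p∈ e≃ = sound (attempt-of f∈c) r q
          in member y∈ (u-complete f∈c ys∈) p∈ e≃
      ; complete = λ p q ys∈ p∈ →
          let _ , f∈c , r  = u-sound p
              _ , g∈c , r′ = u-sound ys∈
              _ , r″ = downward (attempt-of f∈c) r q
              -- The two given pairs may come from different attempts of the family; uniqueness
              -- identifies their values at the predecessor.
              e = attempt-unique _ (attempt-of f∈c) (attempt-of g∈c) r″ r′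
          in ε-respˡ (pair-cong e ≃-refl) (complete (attempt-of f∈c) r q r″ p∈) }
      where
      attempt-of : f ε c → Attempt P f
      attempt-of f∈c = attempt (proj₂ (proj₂ (c-sound f∈c)))

  next-value : M P → M u → M x → ∃[ t ] M t ×
    (∀ {e} → e ε t → Member P u x e) ×
    (∀ {y s p} → y ε x → ⟪ y , s ⟫ ε u → p ε P → ⟪ s , p ⟫ ε t)
  next-value MP Mu Mx =
    let r , Mr , r-complete = M-range Mu
        b , Mb , b-complete = M-product Mr MP
        t , Mt , t-sound , t-complete =
          separate (memberᵈ (# 1) (# 2) (# 3) (# 0)) (MP ∷ Mu ∷ Mx ∷ []) Mb
    in t , Mt , (λ p → proj₂ (t-sound p)) ,
       λ p q r → t-complete (b-complete (r-complete q) r) (member p q r ≃-refl)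

  M-adjoin : M a → M b → ∃[ c ] M c × (∀ {z} → z ε c → z ε a ⊎ z ≃ b) ×
                                (∀ {z} → z ε a → z ε c) × b ε c
  M-adjoin Ma Mb =
    let c , Mc , c-cases , old , new = M-∪ Ma (M-upair Mb Mb)
    in c , Mc ,
       (λ p → [ inj₁ , (λ q → [ inj₂ , inj₂ ] (upair-elim q)) ] (c-cases p)) ,
       old , new upair-left

  -- The pair `⟪ x , t ⟫` is adjoined to the union of the minimal attempts for the elements of `x`.
  -- Minimality survives: an attempt `g` in `M` defined at `x` is defined at those elements and so
  -- contains the union, and its value at `x` is `t` by uniqueness.
  minimalAttempt-exists : M P → ∀ x → M x → ∃[ f ] M f × MinimalAttempt P x f
  minimalAttempt-exists {P} MP = ε-induction λ x IH Mx →
    let u , Mu , U , u-domain , u-sound = attempt-union MP Mx λ p → IH p (M-ε p Mx)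
        t , Mt , t-sound , t-complete = next-value MP Mu Mx
        f , Mf , f-cases , old , new = M-adjoin Mu (M-pair Mx Mt)
        F = attempt-extend U u-domain t-sound t-complete f-cases old
    in f , Mf , record
      { attempt  = F
      ; inDomain = t , new
      ; least    = λ Mg H dom p → [ from-union u-sound Mg H dom
                                  , from-new F new H dom ] (f-cases p) }
    where
    from-union : (∀ {z} → z ε u → ∃₂ λ y f → y ε x × MinimalAttempt P y f × z ε f) →
                 M g → Attempt P g → InDomain g x → ∀ {z} → z ε u → z ε g
    from-union u-sound Mg H (_ , q) p =
      let _ , _ , y∈x , F , r = u-sound p
      in least F Mg H (downward H q y∈x) r

    from-new : Attempt P f → ⟪ x , t ⟫ ε f → Attempt P g → InDomain g x →
               ∀ {z} → z ≃ ⟪ x , t ⟫ → z ε g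
    from-new F p H (_ , q) e = ε-respˡ
      (≃-sym (≃-trans e (pair-cong ≃-refl (attempt-unique _ F H p q)))) q

  -- Γ = { ⟪ p̌ , p ⟫ ∣ p ∈ P } is cut out of P̌.
  generic-name : M P → ∃₂ λ f Γ → Attempt P f × M Γ ×
    (∀ {e} → e ε Γ → ∃[ p ] p ε P × ∃[ s ] ⟪ p , s ⟫ ε f × e ≃ ⟪ s , p ⟫) ×
    (∀ {p} → p ε P → ∃[ s ] ⟪ p , s ⟫ ε f × ⟪ s , p ⟫ ε Γ)
  generic-name {P} MP =
    let f , Mf , F = minimalAttempt-exists MP P MP
        P̌ , PP̌∈f = inDomain F
        Γ , MΓ , Γ-sound , Γ-complete = separate
          (∃εᵈ (# 1) (∃valueᵈ (# 0) (# 3) (pairᵈ (# 2) (# 0) (# 1))))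
          (MP ∷ Mf ∷ []) (M-pairʳ (M-ε PP̌∈f Mf))
    in f , Γ , attempt F , MΓ ,
       (λ q → let p , p∈P , s , r , e = proj₂ (Γ-sound q)
              in p , p∈P , s , r , e) ,
       λ q → let s , r = downward (attempt F) PP̌∈f q
             -- `q` is used twice by `complete`, for `p` as an element of `P` and for `p` as a
             -- condition: this puts `⟪ p̌ , p ⟫` into `P̌`.
             in s , r , Γ-complete (complete (attempt F) PP̌∈f q r q) (_ , q , _ , r , ≃-refl)

-- Evaluation of names and the canonical name of the generic.

val¹-child : (x : V ℓ) (i : index x) → val¹ G x i ≡ val G (child x i)
val¹-child (sup A f) i = refl

val²-child : (x : V ℓ) (i : index² x) → val² G x i ≡ val G (child² x i)
val²-child (sup A f) (i , j) = val¹-child (f i) j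

val-elim : z ε val G τ → ∃₂ λ σ p → ⟪ σ , p ⟫ ε τ × p ε G × z ≃ val G σ
val-elim {z = z} {G = G} {τ = sup A f} (mkε ((a , i , p , e) , q)) =
  child² (f a) i , child G p ,
  ε-respˡ (mk≃ e) (child-ε (sup A f) a) , child-ε G p ,
  mk≃ (subst (z ≅_) (val²-child (f a) i) q)

-- `val` recurses on concrete grandchildren of a child of `τ`, so what gets evaluated is a
-- representative `σ′` of `σ`. Keeping it in the statement avoids a proof that `val` respects `≃`;
-- `val-≃` accordingly asks about every representative.
val-intro : ⟪ σ , p ⟫ ε τ → p ε G → ∃[ σ′ ] σ′ ≃ σ × val G σ′ ε val G τ
val-intro {σ = σ} {p} {τ = sup A f} {G} σp∈τ p∈G =
  let a , e  = ε-child σp∈τ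
      -- The path to `σ` inside the pair runs through its element `⁅ σ , σ ⁆`.
      b , e₁ = ε-child (ε-respʳ e upair-left)
      c , e₂ = ε-child (ε-respʳ e₁ upair-left)
      j , e₃ = ε-child p∈G
      i      = b , c
      entry  = a , i , j , un≃ (≃-trans (≃-sym e) (pair-cong e₂ e₃))
  in child² (f a) i , ≃-sym e₂ ,
     subst (_ε val G (sup A f)) (val²-child (f a) i) (child-ε (val G (sup A f)) entry)

val-≃ : (∀ {σ p} → ⟪ σ , p ⟫ ε τ → p ε G → val G σ ε X) →
        (∀ {y} → y ε X → ∃₂ λ σ p → ⟪ σ , p ⟫ ε τ × p ε G ×
                                     (∀ {σ′} → σ′ ≃ σ → val G σ′ ≃ y)) →
        val G τ ≃ X
val-≃ h k = ε-ext
  (λ p → let _ , _ , q , r , e = val-elim p in ε-respˡ (≃-sym e) (h q r))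
  (λ p → let _ , _ , q , r , e = k p
             _ , e′ , s = val-intro q r
         in ε-respˡ (e e′) s)

isName-intro : (∀ {e} → e ε τ → ∃₂ λ σ p → e ≃ ⟪ σ , p ⟫ × p ε P × IsName P σ) →
               IsName P τ
isName-intro h = name λ p →
  let σ , p , e , q , N = h (mkε p) in σ , p , un≃ e , unε q , N

attempt-isName : Attempt P f → ∀ x → ⟪ x , t ⟫ ε f → IsName P t
attempt-isName {P = P} {f} F x = ε-induction
  {Q = λ x → ∀ {t} → ⟪ x , t ⟫ ε f → IsName P t}
  (λ x IH p → isName-intro λ q →
    let member y∈ ys∈ p∈ e≃ = sound F p q in _ , _ , e≃ , p∈ , IH y∈ ys∈)
  x

attempt-val : Attempt P f → (∀ {p} → p ε G → p ε P) → (∃[ p ] p ε G) →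
              ∀ x → ⟪ x , t ⟫ ε f → val G t ≃ x
attempt-val {P = P} {f} {G} F G⊆P (g , g∈G) x = ε-induction
  {Q = λ x → ∀ {t} → ⟪ x , t ⟫ ε f → val G t ≃ x}
  (λ x IH p → val-≃
    (λ q _ → let member y∈ ys∈ _ e≃ = sound F p q in
      ε-respˡ (≃-sym (IH y∈ (ε-respˡ (pair-cong ≃-refl (≃-sym (pair-injectiveˡ e≃))) ys∈))) y∈)
    -- Since `t` pairs `s` with every condition, the one element `g` of `G` is enough to bring each
    -- `y` into the value.
    (λ y∈ → let s , ys∈ = downward F p y∈ in
      s , g , complete F p y∈ ys∈ (G⊆P g∈G) , g∈G ,
      λ e → IH y∈ (ε-respˡ (pair-cong ≃-refl (≃-sym e)) ys∈)))
  x

generic-in-extension : {M : Pred (V ℓ) m} → IsTransitiveModel M →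
                       (ℙ : ForcingNotion M) → IsGeneric ℙ G → GenericExtension M ℙ G G
generic-in-extension {G = G} isTransitiveModel ℙ isGeneric =
  let f , Γ , F , MΓ , Γ-sound , Γ-complete = generic-name P∈M
      -- That `p̌` evaluates to `p` is needed for all `s′ ≃ s`, because members of `Γ` match
      -- `⟪ s , p ⟫` only up to `≃`.
      value : ∀ {p s s′} → ⟪ p , s ⟫ ε f → s′ ≃ s → val G s′ ≃ p
      value r e = attempt-val F G⊆P (map₂ mkε nonempty) _
                    (ε-respˡ (pair-cong ≃-refl (≃-sym e)) r)
  in Γ , MΓ ,
     isName-intro (λ q →
       let p , p∈P , s , r , e = Γ-sound q
       in s , p , e , p∈P , attempt-isName F p r) ,
     un≃ (≃-sym (val-≃
       (λ q p∈G →
         let _ , _ , _ , r , e = Γ-sound q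
         in ε-respˡ (≃-trans (pair-injectiveʳ e) (≃-sym (value r (pair-injectiveˡ e)))) p∈G)
       (λ p∈G →
         let s , r , q = Γ-complete (G⊆P p∈G)
         in s , _ , q , p∈G , value r)))
  where
  open TransitiveModel isTransitiveModel using (generic-name)
  open ForcingNotion ℙ using (P∈M)
  open IsGeneric isGeneric

  G⊆P : p ε G → p ε ForcingNotion.P ℙ
  G⊆P p = mkε (subset (unε p))

-- Subset Collection in the Kripke model.

module _ (em : ∀ {a} → ExcludedMiddle a) {c ℓ₁ ℓ₂ ℓ m} (𝒦 : KripkeModel c ℓ₁ ℓ₂ ℓ m) where
  open KripkeModel 𝒦
  open Poset frame using () renaming (refl to ≤-refl; trans to ≤-trans)

  -- With arguments x, y, u: for inhabited u ⊆ a this is a total relation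
  -- from a to a whose only possible image is u itself.
  selects : Formula 3
  selects = # 1 ∈̇ # 2 ∧̇ (# 0 ∈̇ # 2 ⇒̇ # 1 =̇ # 0)

  no-new-subsets : (∀ {φ} → CZF φ → Forces φ) →
                   ∀ {v w P G} → v ≤ w → M v P → M w G →
                   (∀ {p} → p ε G → p ε P) → (∃[ p ] p ε G) → M v G
  no-new-subsets forces {v} {w} {P} {G} v≤w MP MG G⊆P (g , g∈G)
    with forces (subsetCollection selects) v ≤-refl P MP ≤-refl P MP
  -- `C` is fixed in `M v` before any `u` is given; `h` then accepts a `u` from any later node.
  ... | C , MC , h
    with h v≤w G MG ≤-refl total
    where
    total : w ⊩ ∀∈ (# 3) (∃∈ (# 3) (inst 6 selects (# 1 ∷ # 0 ∷ # 2 ∷ [])))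
              [ G ∷ C ∷ P ∷ P ∷ [] ]
    -- Membership in `G` is a fact of the ambient universe, the same at all nodes, so it may be
    -- decided classically.
    total w≤w′ x Mx {w″} w′≤w″ x∈P with em {P = x ε G}
    ... | yes x∈G = x , M-mono w′≤w″ Mx , x∈P ,
      lift (unε x∈G) , λ _ _ → lift (≅-refl x)
    -- Any element of `G` serves as image here: the premise of the implication in `selects` fails at
    -- every later node.
    ... | no x∉G = g , M-mono (≤-trans v≤w (≤-trans w≤w′ w′≤w″)) Mg , lift (unε (G⊆P g∈G)) ,
      lift (unε g∈G) , λ _ x∈G → ⊥-elim (x∉G (mkε (lower x∈G)))
      where
      Mg : M v g
      Mg = TransitiveModel.M-ε (isTransitiveModel v) (G⊆P g∈G) MP
  ... | D , MD , D∈C , D-total , D-onto =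
    -- `MD` only places `D` in `M w`; that it lies in `M v` comes from `D∈C` and transitivity.
    TransitiveModel.M-resp (isTransitiveModel v) (ε-ext D⊆G G⊆D)
      (TransitiveModel.M-ε (isTransitiveModel v) (mkε (lower D∈C)) MC)
    where
    open TransitiveModel (isTransitiveModel w) using (M-ε)

    D⊆G : ∀ {y} → y ε D → y ε G
    D⊆G {y} y∈D with D-onto ≤-refl y (M-ε y∈D MD) ≤-refl (lift (unε y∈D))
    ... | _ , _ , _ , y∈G , _ = mkε (lower y∈G)

    G⊆D : ∀ {x} → x ε G → x ε D
    G⊆D {x} x∈G with D-total ≤-refl x (M-ε x∈G MG) ≤-refl (lift (unε (G⊆P x∈G)))
    -- As `x` lies in `G`, the implication in `selects` forces the image found in `D` to be `x`.
    ... | _ , _ , y∈D , _ , y≃x =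
      ε-respˡ (mk≃ (lower (y≃x ≤-refl (lift (unε x∈G))))) (mkε (lower y∈D))

corollary24 : (∀ {a} → ExcludedMiddle a) →
    ∀ {c ℓ₁ ℓ₂ ℓ m} (𝒦 : KripkeModel c ℓ₁ ℓ₂ ℓ m) →
    let open KripkeModel 𝒦 in
    (∃₂ λ v w → v < w × IsNontrivialGenericExtension (M v) (M w)) →
    ¬ (∀ {φ} → CZF φ → Forces φ)
corollary24 em 𝒦 (v , w , (v≤w , _) , ℙ , G , gen , G∉Mv , Mw≐) forces =
  G∉Mv (no-new-subsets em 𝒦 forces v≤w (ForcingNotion.P∈M ℙ)
    (proj₂ Mw≐ (generic-in-extension (KripkeModel.isTransitiveModel 𝒦 v) ℙ gen))
    (λ p → mkε (IsGeneric.subset gen (unε p)))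
    (map₂ mkε (IsGeneric.nonempty gen)))
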